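{- Let $k\ge 3$ be fixed. Suppose that $\mathcal{F}\subset\binom{[n]}{k}$ is a $(k,2k)$-conditionally intersecting family. Then $\mathcal{F}$ can be partitioned into two families $\mathcal{H}$ and $\mathcal{B}$, and the ground set $[n]$ can be partitioned into two subsets $Y$ and $Z$, such that the following statements hold. (a) $\mathcal{H}\subset\binom{Y}{k}$ and every set $H\in\mathcal{H}$ contains a unique $(k-1)$-subset. (b) $\mathcal{B}\subset\binom{Z}{k}$ and $\mathcal{B}$ is the vertex-disjoint union of $\frac{|Z|}{k+1}$ copies of complete $k$-graphs on $k+1$ vertices; that is, $Z$ can be partitioned into $\frac{|Z|}{k+1}$ sets of size $k+1$, and $\mathcal{B}$ consists exactly of all $k$-subsets of these sets.
   Context: $[n]=\{1,\ldots,n\}$, and $\binom{V}{k}$ denotes the collection of all $k$-element subsets of $V$. A family $\mathcal{F}\subset\binom{[n]}{k}$ is called $(d,s)$-conditionally intersecting if there do not exist $d$ distinct sets $A_1,\ldots,A_d\in\mathcal{F}$ with $|A_1\cup\cdots\cup A_d|\le s$ and $A_1\cap\cdots\cap A_d=\emptyset$; here $d=k$ and $s=2k$. For a family $\mathcal{H}\subset 2^{[n]}$ and $H\in\mathcal{H}$, a subset $G\subset H$ is called unique if no set of $\mathcal{H}$ other than $H$ contains $G$. The families $\mathcal{H},\mathcal{B}$ and the sets $Y,Z$ are allowed to be empty. -}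

module Defs where

open import Level using (0ℓ)
open import Data.Nat using (ℕ; suc; _*_; _≤_)
open import Data.Fin using (Fin)
open import Data.Fin.Subset using (Subset; _⊆_; _∪_; _∩_; ⋃; ⋂; ⊤; ⊥; ∣_∣)
open import Data.List using (tabulate)
open import Data.Product using (∃-syntax; _×_)
open import Function.Definitions using (Injective)
open import Relation.Nullary using (¬_)
open import Relation.Unary as U using (Pred)
open import Relation.Binary.PropositionalEquality using (_≡_; _≢_)

-- The ground set [n] is Fin n.  Families of subsets are predicates; being
-- collections of finite objects, they are required to be decidable wherever
-- they are quantified over.
Family : ℕ → Set₁
Family n = Pred (Subset n) 0ℓ

-- binom V k is the collection of all k-element subsets of V.
binom : ∀ {n} → Subset n → ℕ → Family n
binom V k A = A ⊆ V × ∣ A ∣ ≡ k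

ConditionallyIntersecting : ∀ {n} → ℕ → ℕ → Family n → Set
ConditionallyIntersecting {n} d s 𝓕 =
  ¬ (∃[ A ] Injective _≡_ _≡_ A
          × (∀ (i : Fin d) → 𝓕 (A i))
          × ∣ ⋃ (tabulate A) ∣ ≤ s
          × ⋂ (tabulate A) ≡ ⊥ {n})

IsUniqueSubset : ∀ {n} → Family n → Subset n → Subset n → Set
IsUniqueSubset 𝓗 H G = G ⊆ H × (∀ H′ → 𝓗 H′ → H′ ≢ H → ¬ (G ⊆ H′))

ContainsUniqueSubset : ∀ {n} → Family n → ℕ → Subset n → Set
ContainsUniqueSubset 𝓗 j H = ∃[ G ] ∣ G ∣ ≡ j × IsUniqueSubset 𝓗 H G

FamilyPartition : ∀ {n} → Family n → Family n → Family n → Set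
FamilyPartition 𝓕 𝓗 𝓑 = 𝓕 U.≐ (𝓗 U.∪ 𝓑) × 𝓗 U.⊥ 𝓑

GroundPartition : ∀ {n} → Subset n → Subset n → Set
GroundPartition Y Z = Y ∪ Z ≡ ⊤ × Y ∩ Z ≡ ⊥

-- 𝓑 is the vertex-disjoint union of |Z| / (k + 1) complete k-graphs on k + 1
-- vertices, whose vertex sets partition Z.
record IsCliqueUnion {n} (k : ℕ) (Z : Subset n) (𝓑 : Family n) : Set where
  field
    copies   : ℕ
    count    : copies * suc k ≡ ∣ Z ∣
    part     : Fin copies → Subset n
    size     : ∀ i → ∣ part i ∣ ≡ suc k
    disjoint : ∀ i j → i ≢ j → part i ∩ part j ≡ ⊥
    cover    : ⋃ (tabulate part) ≡ Z
    edges    : 𝓑 U.≐ U.⋃ (Fin copies) (λ i → binom (part i) k)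

{-# OPTIONS --safe #-}
-- Call a (k+1)-set a clique if all its k-subsets belong to 𝓕.
--
-- Isolation.  If A ∈ 𝓕 meets a clique K without being contained in it, choose
-- distinct u, v ∈ K ∖ A.  The k − 1 sets K − x with x ∈ K ∖ {u , v}, together
-- with A, have empty intersection and union K ∪ A of size at most 2k, which is
-- forbidden.  Hence cliques are pairwise disjoint.
--
-- Completion.  If no H − x (x ∈ H) is unique to H ∈ 𝓕, then for each x there is
-- y ∉ H with H − x + y ∈ 𝓕.  These k sets have union of size at most 2k, so they
-- have a common element z.  It lies outside H, hence it is the y of every x, and
-- H + z is a clique.
--
-- So 𝓑 consists of the members of 𝓕 lying inside cliques, and Z is the union of
-- the cliques.
module Submission where

open import Defs
open import Data.Bool using (true; false)
open import Data.Nat using (ℕ; zero; suc; _+_; _*_; _∸_; _≤_; _<_; s≤s; s≤s⁻¹)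
open import Data.Nat.Properties
  using (≤-trans; ≤-reflexive; <-irrefl; +-suc; +-comm; +-identityʳ; +-mono-≤;
         +-monoʳ-≤; *-comm; m≤m+n; n≤1+n; suc-injective; _≟_; module ≤-Reasoning)
open import Data.Empty using (⊥-elim)
open import Data.Fin using (Fin; zero; suc)
import Data.Fin.Properties as Fin
open import Data.Fin.Subset as S
  using (Subset; inside; outside; ⊤; ⊥; ∣_∣; _∪_; _∩_; _-_; ∁; ⋃; ⋂; ⁅_⁆; _∈_; _∉_; Nonempty)
open import Data.Fin.Subset.Properties
open import Data.List using (List; []; _∷_; [_]; _++_; map; filter; tabulate; lookup; length)
open import Data.List.Membership.Propositional using () renaming (_∈_ to _∈ˡ_)
open import Data.List.Membership.Propositional.Properties
  using (∈-map⁺; ∈-map⁻; ∈-++⁺ˡ; ∈-++⁺ʳ; ∈-filter⁺; ∈-filter⁻; ∈-lookup)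
import Data.List.Relation.Unary.All as All
open import Data.List.Relation.Unary.Any using (here; there; index)
open import Data.List.Relation.Unary.Any.Properties using (lookup-index)
open import Data.List.Relation.Unary.AllPairs using ([]; _∷_)
open import Data.List.Relation.Unary.Unique.Propositional using (Unique)
import Data.List.Relation.Unary.Unique.Propositional.Properties as Unique
open import Data.Product using (Σ-syntax; ∃-syntax; _×_; _,_; proj₁; proj₂)
open import Data.Sum using (inj₁; inj₂; [_,_]′)
open import Data.Vec using ([]; _∷_; here; there)
open import Data.Vec.Properties using (∷-injectiveʳ)
open import Function using (_∘_; id)
open import Function.Definitions using (Injective)
open import Relation.Binary.PropositionalEquality
  using (_≡_; _≢_; refl; sym; trans; cong; cong₂; subst; ≢-sym)
open import Relation.Nullary using (¬_; yes; no; contradiction)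
open import Relation.Nullary.Decidable using (_×-dec_; _→-dec_; ¬?; decidable-stable)
open import Relation.Unary using (Decidable; _⊆_)

private
  variable
    n m : ℕ
    p q r : Subset n
    x y : Fin n

-- Finite subsets

⊈⇒∃ : ¬ (p S.⊆ q) → ∃[ x ] x ∈ p × x ∉ q
⊈⇒∃ {p = p} {q = q} p⊈q with Fin.any? (λ x → (x ∈? p) ×-dec ¬? (x ∈? q))
... | yes found = found
... | no none = contradiction
  (λ {x} x∈p → decidable-stable (x ∈? q) (λ x∉q → none (x , x∈p , x∉q))) p⊈q

∣∣<⇒∃ : ∣ q ∣ < ∣ p ∣ → ∃[ x ] x ∈ p × x ∉ q
∣∣<⇒∃ ∣q∣<∣p∣ = ⊈⇒∃ λ p⊆q → <-irrefl refl (≤-trans ∣q∣<∣p∣ (p⊆q⇒∣p∣≤∣q∣ p⊆q))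

⊆∧∣∣≥⇒⊇ : p S.⊆ q → ∣ q ∣ ≤ ∣ p ∣ → q S.⊆ p
⊆∧∣∣≥⇒⊇ {p = p} {q = q} p⊆q ∣q∣≤∣p∣ {x} x∈q = decidable-stable (x ∈? p) λ x∉p →
  <-irrefl refl (≤-trans (p⊂q⇒∣p∣<∣q∣ (p⊆q , x , x∈q , x∉p)) ∣q∣≤∣p∣)

⊆∧∣∣≡⇒≡ : p S.⊆ q → ∣ p ∣ ≡ ∣ q ∣ → p ≡ q
⊆∧∣∣≡⇒≡ p⊆q eq = ⊆-antisym p⊆q (⊆∧∣∣≥⇒⊇ p⊆q (≤-reflexive (sym eq)))

∪-least : p S.⊆ r → q S.⊆ r → p ∪ q S.⊆ r
∪-least {p = p} {q = q} p⊆r q⊆r = [ p⊆r , q⊆r ]′ ∘ x∈p∪q⁻ p q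

⁅⁆⊆ : x ∈ p → ⁅ x ⁆ S.⊆ p
⁅⁆⊆ x∈p y∈ with refl ← x∈⁅y⁆⇒x≡y _ y∈ = x∈p

x∉p-x : ∀ (p : Subset n) x → x ∉ p - x
x∉p-x (_ ∷ p) (suc x) (there x∈) = x∉p-x p x x∈

x∈p-y⇒x≢y : ∀ (p : Subset n) → x ∈ p - y → x ≢ y
x∈p-y⇒x≢y p x∈ refl = x∉p-x p _ x∈

p-x⊆p : ∀ (p : Subset n) x → p - x S.⊆ p
p-x⊆p p x = p─q⊆p p ⁅ x ⁆

∣p-x∣ : x ∈ p → suc ∣ p - x ∣ ≡ ∣ p ∣
∣p-x∣ {p = _ ∷ p} here = cong (suc ∘ ∣_∣) (p─⊥≡p p)
∣p-x∣ {p = true ∷ p} (there x∈p) = cong suc (∣p-x∣ x∈p)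
∣p-x∣ {p = false ∷ p} (there x∈p) = ∣p-x∣ x∈p

∣p∪q∣+∣p∩q∣ : ∀ (p q : Subset n) → ∣ p ∪ q ∣ + ∣ p ∩ q ∣ ≡ ∣ p ∣ + ∣ q ∣
∣p∪q∣+∣p∩q∣ [] [] = refl
∣p∪q∣+∣p∩q∣ (true ∷ p) (true ∷ q)
  rewrite +-suc ∣ p ∪ q ∣ ∣ p ∩ q ∣ | +-suc ∣ p ∣ ∣ q ∣ = cong (2 +_) (∣p∪q∣+∣p∩q∣ p q)
∣p∪q∣+∣p∩q∣ (true ∷ p) (false ∷ q) = cong suc (∣p∪q∣+∣p∩q∣ p q)
∣p∪q∣+∣p∩q∣ (false ∷ p) (true ∷ q)
  rewrite +-suc ∣ p ∣ ∣ q ∣ = cong suc (∣p∪q∣+∣p∩q∣ p q)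
∣p∪q∣+∣p∩q∣ (false ∷ p) (false ∷ q) = ∣p∪q∣+∣p∩q∣ p q

∣p∪q∣≤ : ∀ (p q : Subset n) → ∣ p ∪ q ∣ ≤ ∣ p ∣ + ∣ q ∣
∣p∪q∣≤ p q = ≤-trans (m≤m+n _ _) (≤-reflexive (∣p∪q∣+∣p∩q∣ p q))

disjoint⇒∣p∪q∣ : ∀ (p q : Subset n) → p ∩ q ≡ ⊥ → ∣ p ∪ q ∣ ≡ ∣ p ∣ + ∣ q ∣
disjoint⇒∣p∪q∣ {n} p q p∩q≡⊥ with eq ← ∣p∪q∣+∣p∩q∣ p q
  rewrite p∩q≡⊥ | ∣⊥∣≡0 n = trans (sym (+-identityʳ _)) eq

∉⇒∩⁅⁆≡⊥ : x ∉ p → p ∩ ⁅ x ⁆ ≡ ⊥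
∉⇒∩⁅⁆≡⊥ {x = x} {p = p} x∉p = Empty-unique λ (y , y∈) →
  let y∈p , y∈x = x∈p∩q⁻ p ⁅ x ⁆ y∈ in x∉p (subst (_∈ p) (x∈⁅y⁆⇒x≡y x y∈x) y∈p)

∣p∪⁅x⁆∣ : x ∉ p → ∣ p ∪ ⁅ x ⁆ ∣ ≡ suc ∣ p ∣
∣p∪⁅x⁆∣ {x = x} {p = p} x∉p
  with eq ← disjoint⇒∣p∪q∣ p ⁅ x ⁆ (∉⇒∩⁅⁆≡⊥ x∉p)
  rewrite ∣⁅x⁆∣≡1 x = trans eq (+-comm ∣ p ∣ 1)

thirdElement : 3 ≤ ∣ p ∣ → ∀ x y → ∃[ z ] z ∈ p × z ≢ x × z ≢ y
thirdElement {p = p} 3≤∣p∣ x y with ∣∣<⇒∃ {q = ⁅ x ⁆ ∪ ⁅ y ⁆} {p = p} (≤-trans (s≤s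
  (≤-trans (∣p∪q∣≤ ⁅ x ⁆ ⁅ y ⁆) (≤-reflexive (cong₂ _+_ (∣⁅x⁆∣≡1 x) (∣⁅x⁆∣≡1 y))))) 3≤∣p∣)
... | z , z∈p , z∉xy = z , z∈p
  , (λ { refl → z∉xy (x∈p∪q⁺ (inj₁ (x∈⁅x⁆ z))) })
  , (λ { refl → z∉xy (x∈p∪q⁺ (inj₂ (x∈⁅x⁆ z))) })

∣p-x∪⁅y⁆∣ : x ∈ p → y ∉ p → ∣ (p - x) ∪ ⁅ y ⁆ ∣ ≡ ∣ p ∣
∣p-x∪⁅y⁆∣ {x = x} {p = p} x∈p y∉p = trans (∣p∪⁅x⁆∣ (y∉p ∘ p-x⊆p p x)) (∣p-x∣ x∈p)

-- Unions and intersections of indexed families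

x∈⋃⁺ : ∀ (f : Fin m → Subset n) i → x ∈ f i → x ∈ ⋃ (tabulate f)
x∈⋃⁺ f zero x∈ = x∈p∪q⁺ (inj₁ x∈)
x∈⋃⁺ f (suc i) x∈ = x∈p∪q⁺ (inj₂ (x∈⋃⁺ (f ∘ suc) i x∈))

x∈⋃⁻ : ∀ (f : Fin m → Subset n) → x ∈ ⋃ (tabulate f) → ∃[ i ] x ∈ f i
x∈⋃⁻ {zero} f x∈ = contradiction x∈ ∉⊥
x∈⋃⁻ {suc m} f x∈ with x∈p∪q⁻ (f zero) _ x∈
... | inj₁ x∈f₀ = zero , x∈f₀
... | inj₂ x∈fₛ = let i , x∈fᵢ = x∈⋃⁻ (f ∘ suc) x∈fₛ in suc i , x∈fᵢ

x∈⋂⁻ : ∀ (f : Fin m → Subset n) → x ∈ ⋂ (tabulate f) → ∀ i → x ∈ f i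
x∈⋂⁻ f x∈ zero = proj₁ (x∈p∩q⁻ (f zero) _ x∈)
x∈⋂⁻ f x∈ (suc i) = x∈⋂⁻ (f ∘ suc) (proj₂ (x∈p∩q⁻ (f zero) _ x∈)) i

⋃-least : ∀ (f : Fin m → Subset n) → (∀ i → f i S.⊆ p) → ⋃ (tabulate f) S.⊆ p
⋃-least f f⊆p x∈ = let i , x∈fᵢ = x∈⋃⁻ f x∈ in f⊆p i x∈fᵢ

∣⋃∣≤ : ∀ (f : Fin m → Subset n) c → (∀ i → ∣ f i ∣ ≤ c) → ∣ ⋃ (tabulate f) ∣ ≤ m * c
∣⋃∣≤ {zero} {n} f c _ = ≤-reflexive (∣⊥∣≡0 n)
∣⋃∣≤ {suc m} f c f≤c =
  ≤-trans (∣p∪q∣≤ (f zero) _) (+-mono-≤ (f≤c zero) (∣⋃∣≤ (f ∘ suc) c (f≤c ∘ suc)))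

disjoint⇒∣⋃∣ : ∀ (f : Fin m → Subset n) c → (∀ i → ∣ f i ∣ ≡ c) →
  (∀ i j → i ≢ j → f i ∩ f j ≡ ⊥) → m * c ≡ ∣ ⋃ (tabulate f) ∣
disjoint⇒∣⋃∣ {zero} {n} f c _ _ = sym (∣⊥∣≡0 n)
disjoint⇒∣⋃∣ {suc m} f c size disj
  rewrite disjoint⇒∣p∪q∣ (f zero) (⋃ (tabulate (f ∘ suc))) (Empty-unique λ (x , x∈) →
            let x∈f₀ , x∈⋃ = x∈p∩q⁻ (f zero) _ x∈
                i , x∈fᵢ = x∈⋃⁻ (f ∘ suc) x∈⋃
            in ∉⊥ (subst (x ∈_) (disj zero (suc i) λ ()) (x∈p∩q⁺ (x∈f₀ , x∈fᵢ))))
        | size zero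
  = cong (c +_) (disjoint⇒∣⋃∣ (f ∘ suc) c (size ∘ suc)
      (λ i j i≢j → disj (suc i) (suc j) (i≢j ∘ Fin.suc-injective)))

-- Enumeration of the elements of a subset and of all subsets

element : ∀ (p : Subset n) → Fin ∣ p ∣ → Fin n
element (true ∷ p) zero = zero
element (true ∷ p) (suc i) = suc (element p i)
element (false ∷ p) i = suc (element p i)

element-∈ : ∀ (p : Subset n) i → element p i ∈ p
element-∈ (true ∷ p) zero = here
element-∈ (true ∷ p) (suc i) = there (element-∈ p i)
element-∈ (false ∷ p) i = there (element-∈ p i)

element-injective : ∀ (p : Subset n) → Injective _≡_ _≡_ (element p)
element-injective (true ∷ p) {zero} {zero} eq = refl
element-injective (true ∷ p) {suc i} {suc j} eq =
  cong suc (element-injective p (Fin.suc-injective eq))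
element-injective (false ∷ p) eq = element-injective p (Fin.suc-injective eq)

element-surjective : x ∈ p → ∃[ i ] element p i ≡ x
element-surjective here = zero , refl
element-surjective {p = true ∷ p} (there x∈p) =
  let i , eq = element-surjective x∈p in suc i , cong suc eq
element-surjective {p = false ∷ p} (there x∈p) =
  let i , eq = element-surjective x∈p in i , cong suc eq

subsets : ∀ n → List (Subset n)
subsets zero = [ [] ]
subsets (suc n) = map (inside ∷_) (subsets n) ++ map (outside ∷_) (subsets n)

∈-subsets : ∀ (p : Subset n) → p ∈ˡ subsets n
∈-subsets [] = here refl
∈-subsets (true ∷ p) = ∈-++⁺ˡ (∈-map⁺ _ (∈-subsets p))
∈-subsets {suc n} (false ∷ p) =
  ∈-++⁺ʳ (map (inside ∷_) (subsets n)) (∈-map⁺ _ (∈-subsets p))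

subsets-unique : ∀ n → Unique (subsets n)
subsets-unique zero = All.[] ∷ []
subsets-unique (suc n) = Unique.++⁺
  (Unique.map⁺ ∷-injectiveʳ (subsets-unique n))
  (Unique.map⁺ ∷-injectiveʳ (subsets-unique n))
  λ (∈in , ∈out) → ¬both (∈-map⁻ _ ∈in) (∈-map⁻ _ ∈out)
  where
  ¬both : ∀ {r : Subset (suc n)} →
    ∃[ p ] p ∈ˡ subsets n × r ≡ inside ∷ p → ¬ (∃[ q ] q ∈ˡ subsets n × r ≡ outside ∷ q)
  ¬both (_ , _ , refl) (_ , _ , ())

-- Used to index the cliques by positions in a repetition-free list: different positions then hold
-- different cliques, which are disjoint.
lookup-injective : ∀ {A : Set} {xs : List A} → Unique xs → Injective _≡_ _≡_ (lookup xs)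
lookup-injective (_ ∷ _) {zero} {zero} _ = refl
lookup-injective (x∉ ∷ _) {zero} {suc j} eq = contradiction eq (All.lookup x∉ (∈-lookup j))
lookup-injective (x∉ ∷ _) {suc i} {zero} eq = contradiction (sym eq) (All.lookup x∉ (∈-lookup i))
lookup-injective (_ ∷ u) {suc i} {suc j} eq = cong suc (lookup-injective u eq)

-- Cliques

-- The `k`-subsets of a set of size `suc k` are exactly its one-point deletions, so testing these
-- suffices and the test runs over single vertices.
IsClique : ℕ → Family n → Family n
IsClique k 𝓕 K = ∣ K ∣ ≡ suc k × (∀ x → x ∈ K → 𝓕 (K - x))

InClique : ℕ → Family n → Family n
InClique k 𝓕 A = ∃[ K ] IsClique k 𝓕 K × A S.⊆ K

-- For `x ∈ H` and a uniform `𝓕` containing `H`, this says that `H - x` is not unique to `H`: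
-- another member containing `H - x` has just one further element `y`.
Replaceable : Family n → Subset n → Fin n → Set
Replaceable 𝓕 H x = ∃[ y ] y ∉ H × 𝓕 ((H - x) ∪ ⁅ y ⁆)

-- The contrapositive of conditional intersection. Bounding the union by any `U` avoids computing it
-- exactly.
commonElement : ∀ {d s} {𝓕 : Family n} → ConditionallyIntersecting d s 𝓕 →
  (A : Fin d → Subset n) → Injective _≡_ _≡_ A → (∀ i → 𝓕 (A i)) →
  ∀ U → (∀ i → A i S.⊆ U) → ∣ U ∣ ≤ s → ∃[ z ] (∀ i → z ∈ A i)
commonElement ci A inj A∈𝓕 U A⊆U ∣U∣≤s with nonempty? (⋂ (tabulate A))
... | yes (z , z∈) = z , x∈⋂⁻ A z∈
... | no empty = ⊥-elim (ci
  (A , inj , A∈𝓕 , ≤-trans (p⊆q⇒∣p∣≤∣q∣ (⋃-least A A⊆U)) ∣U∣≤s , Empty-unique empty))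

-- By size, `A` misses some vertex `x` of `K`, and by size again it fills `K - x`.
clique-⊇ : ∀ {k} {𝓕 : Family n} {K A} → IsClique k 𝓕 K → A S.⊆ K → ∣ A ∣ ≡ k → 𝓕 A
clique-⊇ {𝓕 = 𝓕} {K} {A} (∣K∣ , K-x∈𝓕) A⊆K ∣A∣ =
  let x , x∈K , x∉A = ∣∣<⇒∃ (≤-reflexive (trans (cong suc ∣A∣) (sym ∣K∣)))
      A⊆K-x : A S.⊆ K - x
      A⊆K-x y∈A = x∈p∧x≢y⇒x∈p-y (A⊆K y∈A) (λ { refl → x∉A y∈A })
      A≡K-x = ⊆∧∣∣≡⇒≡ A⊆K-x (suc-injective
        (trans (cong suc ∣A∣) (trans (sym ∣K∣) (sym (∣p-x∣ x∈K)))))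
  in subst 𝓕 (sym A≡K-x) (K-x∈𝓕 x x∈K)

-- Isolation of cliques

isolation : ∀ {k} {𝓕 : Family n} {K A} → 𝓕 ⊆ binom ⊤ k →
  ConditionallyIntersecting k (2 * k) 𝓕 → IsClique k 𝓕 K →
  𝓕 A → Nonempty (K ∩ A) → A S.⊆ K
isolation {n} {k} {𝓕} {K} {A} 𝓕⊆ ci (∣K∣ , K-x∈𝓕) A∈𝓕 (w , w∈K∩A) =
  decidable-stable (A ⊆? K) ¬¬A⊆K
  where
  ∣A∣ : ∣ A ∣ ≡ k
  ∣A∣ = proj₂ (𝓕⊆ A∈𝓕)

  w∈K = proj₁ (x∈p∩q⁻ K A w∈K∩A)
  w∈A = proj₂ (x∈p∩q⁻ K A w∈K∩A)

  1≤∣K∩A∣ : 1 ≤ ∣ K ∩ A ∣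
  1≤∣K∩A∣ = subst (_≤ ∣ K ∩ A ∣) (∣⁅x⁆∣≡1 w) (p⊆q⇒∣p∣≤∣q∣ (⁅⁆⊆ w∈K∩A))

  -- The sizes sum to `2 * k + 1`, and the shared vertex `w` saves one.
  ∣K∪A∣≤2k : ∣ K ∪ A ∣ ≤ 2 * k
  ∣K∪A∣≤2k = s≤s⁻¹ (begin
    suc ∣ K ∪ A ∣           ≡⟨ +-comm 1 _ ⟩
    ∣ K ∪ A ∣ + 1           ≤⟨ +-monoʳ-≤ ∣ K ∪ A ∣ 1≤∣K∩A∣ ⟩
    ∣ K ∪ A ∣ + ∣ K ∩ A ∣   ≡⟨ ∣p∪q∣+∣p∩q∣ K A ⟩
    ∣ K ∣ + ∣ A ∣           ≡⟨ cong₂ _+_ ∣K∣ ∣A∣ ⟩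
    suc k + k               ≡⟨ cong (λ j → suc (k + j)) (sym (+-identityʳ k)) ⟩
    suc (2 * k)             ∎)
    where open ≤-Reasoning

  ¬¬A⊆K : ¬ ¬ (A S.⊆ K)
  ¬¬A⊆K A⊈K = no-common (commonElement {𝓕 = 𝓕} ci′ B B-injective B∈𝓕 (K ∪ A) B⊆ ∣K∪A∣≤2k)
    where
    K⊈A : ∃[ u ] u ∈ K × u ∉ A
    K⊈A = ∣∣<⇒∃ (≤-reflexive (trans (cong suc ∣A∣) (sym ∣K∣)))
    u = proj₁ K⊈A
    u∈K = proj₁ (proj₂ K⊈A)
    u∉A = proj₂ (proj₂ K⊈A)

    P : Subset n
    P = K - u

    ∣P∣ : ∣ P ∣ ≡ k
    ∣P∣ = suc-injective (trans (∣p-x∣ u∈K) ∣K∣)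

    -- If `P` were contained in `A`, equal sizes would give `A ⊆ P ⊆ K`.
    P⊈A : ∃[ v ] v ∈ P × v ∉ A
    P⊈A = ⊈⇒∃ λ P⊆A → A⊈K
      (p-x⊆p K u ∘ ⊆∧∣∣≥⇒⊇ P⊆A (≤-reflexive (trans ∣A∣ (sym ∣P∣))))
    v = proj₁ P⊈A
    v∈P = proj₁ (proj₂ P⊈A)
    v∉A = proj₂ (proj₂ P⊈A)

    ci′ : ConditionallyIntersecting ∣ P ∣ (2 * k) 𝓕
    ci′ = subst (λ d → ConditionallyIntersecting d (2 * k) 𝓕) (sym ∣P∣) ci

    -- The forbidden sets are indexed by the `k` elements of `P`: each `x` gives `K - x`, except
    -- that `A` takes the place of `K - v`.
    C : Fin n → Subset n
    C x with x Fin.≟ v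
    ... | yes _ = A
    ... | no _ = K - x

    C-v : C v ≡ A
    C-v with v Fin.≟ v
    ... | yes _ = refl
    ... | no v≢v = contradiction refl v≢v

    C-≢ : x ≢ v → C x ≡ K - x
    C-≢ {x} x≢v with x Fin.≟ v
    ... | yes x≡v = contradiction x≡v x≢v
    ... | no _ = refl

    C-injective : x ∈ K → y ∈ K → C x ≡ C y → x ≡ y
    C-injective {x} {y} x∈K y∈K eq with x Fin.≟ v | y Fin.≟ v
    ... | yes refl | yes refl = refl
    ... | yes _ | no _ = ⊥-elim (A⊈K (subst (S._⊆ K) (sym eq) (p-x⊆p K y)))
    ... | no _ | yes _ = ⊥-elim (A⊈K (subst (S._⊆ K) eq (p-x⊆p K x)))
    ... | no _ | no _ = decidable-stable (x Fin.≟ y) λ x≢y →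
      x∉p-x K x (subst (x ∈_) (sym eq) (x∈p∧x≢y⇒x∈p-y x∈K x≢y))

    C∈𝓕 : x ∈ K → 𝓕 (C x)
    C∈𝓕 {x} x∈K with x Fin.≟ v
    ... | yes _ = A∈𝓕
    ... | no _ = K-x∈𝓕 x x∈K

    C⊆ : ∀ x → C x S.⊆ K ∪ A
    C⊆ x with x Fin.≟ v
    ... | yes _ = q⊆p∪q K A
    ... | no _ = p⊆p∪q A ∘ p-x⊆p K x

    element-∈K : ∀ i → element P i ∈ K
    element-∈K = p-x⊆p K u ∘ element-∈ P

    B : Fin ∣ P ∣ → Subset n
    B = C ∘ element P

    B-injective : Injective _≡_ _≡_ B
    B-injective = element-injective P ∘ C-injective (element-∈K _) (element-∈K _)

    B∈𝓕 : ∀ i → 𝓕 (B i)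
    B∈𝓕 = C∈𝓕 ∘ element-∈K

    B⊆ : ∀ i → B i S.⊆ K ∪ A
    B⊆ = C⊆ ∘ element P

    -- A common `z` lies in `A`, so it is neither `u` nor `v`. The set indexed by `w` is `K - w`,
    -- which puts `z` in `K` and hence in `P`. Then the set indexed by `z` is `K - z`, which omits
    -- `z`.
    no-common : ¬ (∃[ z ] (∀ i → z ∈ B i))
    no-common (z , z∈B) = x∉p-x K z (subst (z ∈_) (C-≢ z≢v) (z∈C z∈P))
      where
      z∈C : x ∈ P → z ∈ C x
      z∈C x∈P = let i , eq = element-surjective x∈P in subst (λ x → z ∈ C x) eq (z∈B i)
      z∈A = subst (z ∈_) C-v (z∈C v∈P)
      z≢v : z ≢ v
      z≢v refl = v∉A z∈A
      w∈P : w ∈ P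
      w∈P = x∈p∧x≢y⇒x∈p-y w∈K λ w≡u → u∉A (subst (_∈ A) w≡u w∈A)
      w≢v : w ≢ v
      w≢v w≡v = v∉A (subst (_∈ A) w≡v w∈A)
      z∈P : z ∈ P
      z∈P = x∈p∧x≢y⇒x∈p-y (p-x⊆p K w (subst (z ∈_) (C-≢ w≢v) (z∈C w∈P)))
        λ z≡u → u∉A (subst (_∈ A) z≡u z∈A)

-- Suppose `w` is shared. For any `z ∈ L`, delete from `L` a vertex `t` other than `w` and `z`: the
-- remaining edge meets `K` in `w`, so isolation places it, and with it `z`, in `K`. Thus `L ⊆ K`,
-- and equal sizes give `L ≡ K`.
cliques-disjoint : ∀ {k} {𝓕 : Family n} {K L} → 3 ≤ k → 𝓕 ⊆ binom ⊤ k →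
  ConditionallyIntersecting k (2 * k) 𝓕 → IsClique k 𝓕 K → IsClique k 𝓕 L →
  K ≢ L → K ∩ L ≡ ⊥
cliques-disjoint {k = k} {K = K} {L} 3≤k 𝓕⊆ ci Kc Lc K≢L = Empty-unique λ (w , w∈) →
  let w∈K , w∈L = x∈p∩q⁻ K L w∈
      L⊆K : L S.⊆ K
      L⊆K {z} z∈L =
        let t , t∈L , t≢w , t≢z = thirdElement 3≤∣L∣ w z
            w∈L-t = x∈p∧x≢y⇒x∈p-y w∈L (≢-sym t≢w)
            z∈L-t = x∈p∧x≢y⇒x∈p-y z∈L (≢-sym t≢z)
        in isolation 𝓕⊆ ci Kc (proj₂ Lc t t∈L) (w , x∈p∩q⁺ (w∈K , w∈L-t)) z∈L-t
  in K≢L (sym (⊆∧∣∣≡⇒≡ L⊆K (trans (proj₁ Lc) (sym (proj₁ Kc)))))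
  where
  3≤∣L∣ : 3 ≤ ∣ L ∣
  3≤∣L∣ = ≤-trans 3≤k (≤-trans (n≤1+n k) (≤-reflexive (sym (proj₁ Lc))))

-- Completion to a clique, and unique subsets

replaceable⇒inClique : ∀ {k} {𝓕 : Family n} {H} → ConditionallyIntersecting k (2 * k) 𝓕 →
  𝓕 H → ∣ H ∣ ≡ k → (∀ x → x ∈ H → Replaceable 𝓕 H x) → InClique k 𝓕 H
replaceable⇒inClique {n} {𝓕 = 𝓕} {H} ci H∈𝓕 refl replace =
  H ∪ ⁅ z ⁆ , (∣p∪⁅x⁆∣ z∉H , deletion∈𝓕) , p⊆p∪q ⁅ z ⁆
  where
  -- Matching the size equation with `refl` lets `Fin k` enumerate `H` without transport.
  k = ∣ H ∣
  e = element H

  y′ : Fin k → Fin n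
  y′ i = proj₁ (replace (e i) (element-∈ H i))

  y′∉H : ∀ i → y′ i ∉ H
  y′∉H i = proj₁ (proj₂ (replace (e i) (element-∈ H i)))

  A : Fin k → Subset n
  A i = (H - e i) ∪ ⁅ y′ i ⁆

  e∉A : ∀ i → e i ∉ A i
  e∉A i e∈A with x∈p∪q⁻ (H - e i) _ e∈A
  ... | inj₁ e∈H-e = x∉p-x H (e i) e∈H-e
  ... | inj₂ e∈y = y′∉H i (subst (_∈ H) (x∈⁅y⁆⇒x≡y _ e∈y) (element-∈ H i))

  -- `A i` omits `e i`, while every `A j` with `e j ≢ e i` retains it.
  A-injective : Injective _≡_ _≡_ A
  A-injective {i} {j} eq = element-injective H (decidable-stable (e i Fin.≟ e j) λ eᵢ≢eⱼ →
    e∉A i (subst (e i ∈_) (sym eq) (x∈p∪q⁺ (inj₁ (x∈p∧x≢y⇒x∈p-y (element-∈ H i) eᵢ≢eⱼ)))))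

  -- The replacements may coincide, but there are at most `k` of them, so `H ∪ Y` has at most
  -- `2 * k` elements.
  Y : Subset n
  Y = ⋃ (tabulate (⁅_⁆ ∘ y′))

  A⊆H∪Y : ∀ i → A i S.⊆ H ∪ Y
  A⊆H∪Y i = ∪-least (p⊆p∪q Y ∘ p-x⊆p H (e i)) (q⊆p∪q H Y ∘ x∈⋃⁺ (⁅_⁆ ∘ y′) i)

  ∣H∪Y∣≤2k : ∣ H ∪ Y ∣ ≤ 2 * k
  ∣H∪Y∣≤2k = ≤-trans (∣p∪q∣≤ H Y) (+-monoʳ-≤ k (≤-trans
    (∣⋃∣≤ (⁅_⁆ ∘ y′) 1 (≤-reflexive ∘ ∣⁅x⁆∣≡1 ∘ y′))
    (≤-reflexive (*-comm k 1))))

  common : ∃[ z ] (∀ i → z ∈ A i)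
  common = commonElement {𝓕 = 𝓕} ci A A-injective
    (λ i → proj₂ (proj₂ (replace (e i) (element-∈ H i)))) (H ∪ Y) A⊆H∪Y ∣H∪Y∣≤2k

  z = proj₁ common

  -- Each element of `H` is some `e i`, and is therefore absent from `A i`.
  z∉H : z ∉ H
  z∉H z∈H = let i , eᵢ≡z = element-surjective z∈H in
    e∉A i (subst (_∈ A i) (sym eᵢ≡z) (proj₂ common i))

  z≡y′ : ∀ i → z ≡ y′ i
  z≡y′ i = [ (λ z∈ → contradiction (p-x⊆p H (e i) z∈) z∉H) , x∈⁅y⁆⇒x≡y _ ]′
    (x∈p∪q⁻ (H - e i) _ (proj₂ common i))

  exchange∈𝓕 : x ∈ H → 𝓕 ((H - x) ∪ ⁅ z ⁆)
  exchange∈𝓕 x∈H with i , refl ← element-surjective x∈H =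
    subst (λ y → 𝓕 ((H - e i) ∪ ⁅ y ⁆)) (sym (z≡y′ i))
      (proj₂ (proj₂ (replace (e i) (element-∈ H i))))

  K = H ∪ ⁅ z ⁆

  ∣H∣≡∣K-x∣ : x ∈ K → ∣ H ∣ ≡ ∣ K - x ∣
  ∣H∣≡∣K-x∣ x∈K = suc-injective (trans (sym (∣p∪⁅x⁆∣ z∉H)) (sym (∣p-x∣ x∈K)))

  -- Deleting `z` gives back `H`; deleting `x ∈ H` gives the exchange of `x` for `z`.
  deletion∈𝓕 : ∀ x → x ∈ K → 𝓕 (K - x)
  deletion∈𝓕 x x∈K with x Fin.≟ z
  ... | yes refl = subst 𝓕 (⊆∧∣∣≡⇒≡ H⊆K-z (∣H∣≡∣K-x∣ x∈K)) H∈𝓕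
    where
    H⊆K-z : H S.⊆ K - z
    H⊆K-z h∈H = x∈p∧x≢y⇒x∈p-y (p⊆p∪q ⁅ z ⁆ h∈H) λ h≡z → z∉H (subst (_∈ H) h≡z h∈H)
  ... | no x≢z = subst 𝓕
      (⊆∧∣∣≡⇒≡ exchange⊆K-x (trans (∣p-x∪⁅y⁆∣ x∈H z∉H) (∣H∣≡∣K-x∣ x∈K))) (exchange∈𝓕 x∈H)
    where
    x∈H : x ∈ H
    x∈H = [ id , (λ x∈z → contradiction (x∈⁅y⁆⇒x≡y z x∈z) x≢z) ]′ (x∈p∪q⁻ H ⁅ z ⁆ x∈K)
    exchange⊆K-x : (H - x) ∪ ⁅ z ⁆ S.⊆ K - x
    exchange⊆K-x = ∪-least
      (λ h∈ → x∈p∧x≢y⇒x∈p-y (p⊆p∪q ⁅ z ⁆ (p-x⊆p H x h∈)) (x∈p-y⇒x≢y H h∈))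
      (⁅⁆⊆ (x∈p∧x≢y⇒x∈p-y (q⊆p∪q H ⁅ z ⁆ (x∈⁅x⁆ z)) (≢-sym x≢z)))

-- Another member `H′` containing `H - x` has an element `y` outside `H`. By size it equals `H - x`
-- with `y` added, so `y` would replace `x`. Excluding replacements in `𝓕` also excludes them in the
-- subfamily `𝓗`.
irreplaceable⇒uniqueSubset : ∀ {k} {𝓕 𝓗 : Family n} {H} → 𝓕 ⊆ binom ⊤ k → 𝓗 ⊆ 𝓕 →
  ∣ H ∣ ≡ k → x ∈ H → ¬ Replaceable 𝓕 H x → ContainsUniqueSubset 𝓗 (k ∸ 1) H
irreplaceable⇒uniqueSubset {x = x} {k = k} {𝓕} {𝓗} {H} 𝓕⊆ 𝓗⊆𝓕 ∣H∣ x∈H irr =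
  H - x , cong (_∸ 1) (trans (∣p-x∣ x∈H) ∣H∣) , p-x⊆p H x , unique
  where
  unique : ∀ H′ → 𝓗 H′ → H′ ≢ H → ¬ (H - x S.⊆ H′)
  unique H′ H′∈𝓗 H′≢H H-x⊆H′ =
    let ∣H′∣ = proj₂ (𝓕⊆ (𝓗⊆𝓕 H′∈𝓗))
        y , y∈H′ , y∉H = ⊈⇒∃ λ H′⊆H → H′≢H (⊆∧∣∣≡⇒≡ H′⊆H (trans ∣H′∣ (sym ∣H∣)))
        exchange≡H′ = ⊆∧∣∣≡⇒≡ (∪-least H-x⊆H′ (⁅⁆⊆ y∈H′))
          (trans (∣p-x∪⁅y⁆∣ x∈H y∉H) (trans ∣H∣ (sym ∣H′∣)))
    in irr (y , y∉H , subst 𝓕 (sym exchange≡H′) (𝓗⊆𝓕 H′∈𝓗))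

-- Assembly of the two partitions from the cliques

theorem1p7 : ∀ (k : ℕ) → 3 ≤ k →
    ∀ (n : ℕ) (𝓕 : Family n) → Decidable 𝓕 →
    𝓕 ⊆ binom ⊤ k →
    ConditionallyIntersecting k (2 * k) 𝓕 →
    Σ[ 𝓗 ∈ Family n ] Σ[ 𝓑 ∈ Family n ] Σ[ Y ∈ Subset n ] Σ[ Z ∈ Subset n ]
    ( (Decidable 𝓗 × Decidable 𝓑)
    × FamilyPartition 𝓕 𝓗 𝓑
    × GroundPartition Y Z
    × (𝓗 ⊆ binom Y k × (∀ H → 𝓗 H → ContainsUniqueSubset 𝓗 (k ∸ 1) H))
    × (𝓑 ⊆ binom Z k × IsCliqueUnion k Z 𝓑) )
theorem1p7 k 3≤k n 𝓕 𝓕? 𝓕⊆ ci =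
  𝓗 , 𝓑 , ∁ Z , Z
  , ((λ A → 𝓕? A ×-dec ¬? (inClique? A)) , (λ A → 𝓕? A ×-dec inClique? A))
  , ((split , [ proj₁ , proj₁ ]′) , λ ((_ , A∉) , (_ , A∈)) → A∉ A∈)
  , (trans (∪-comm (∁ Z) Z) (p∪∁p≡⊤ Z) , ∩-inverseˡ Z)
  , (𝓗⊆Y , 𝓗-unique)
  , (𝓑⊆Z , record
      { copies = length cliques
      ; count = disjoint⇒∣⋃∣ part (suc k) (proj₁ ∘ part-clique) part-disjoint
      ; part = part
      ; size = proj₁ ∘ part-clique
      ; disjoint = part-disjoint
      ; cover = refl
      -- Any clique witnessing membership in `𝓑` is one of the parts; conversely, every `k`-subset
      -- of a part is in `𝓕`.
      ; edges = (λ (A∈𝓕 , _ , Kc , A⊆K) →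
                  let i , K≡ = part-complete Kc in
                  i , subst (_ S.⊆_) K≡ A⊆K , proj₂ (𝓕⊆ A∈𝓕))
              , (λ (i , A⊆ , ∣A∣) →
                  clique-⊇ {𝓕 = 𝓕} (part-clique i) A⊆ ∣A∣ , part i , part-clique i , A⊆)
      })
  where
  isClique? : Decidable (IsClique k 𝓕)
  isClique? K = (∣ K ∣ ≟ suc k) ×-dec Fin.all? (λ x → (x ∈? K) →-dec 𝓕? (K - x))

  inClique? : Decidable (InClique k 𝓕)
  inClique? A = anySubset? (λ K → isClique? K ×-dec (A ⊆? K))

  replaceable? : ∀ H → Decidable (Replaceable 𝓕 H)
  replaceable? H x = Fin.any? (λ y → ¬? (y ∈? H) ×-dec 𝓕? ((H - x) ∪ ⁅ y ⁆))

  𝓗 𝓑 : Family n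
  𝓗 A = 𝓕 A × ¬ InClique k 𝓕 A
  𝓑 A = 𝓕 A × InClique k 𝓕 A

  cliques : List (Subset n)
  cliques = filter isClique? (subsets n)

  part : Fin (length cliques) → Subset n
  part = lookup cliques

  Z : Subset n
  Z = ⋃ (tabulate part)

  part-clique : ∀ i → IsClique k 𝓕 (part i)
  part-clique i = proj₂ (∈-filter⁻ isClique? {xs = subsets n} (∈-lookup i))

  part-complete : ∀ {K} → IsClique k 𝓕 K → ∃[ i ] K ≡ part i
  part-complete {K} Kc =
    let K∈ = ∈-filter⁺ isClique? (∈-subsets K) Kc in index K∈ , lookup-index K∈

  part-disjoint : ∀ i j → i ≢ j → part i ∩ part j ≡ ⊥
  part-disjoint i j i≢j = cliques-disjoint 3≤k 𝓕⊆ ci (part-clique i) (part-clique j)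
    (i≢j ∘ lookup-injective (Unique.filter⁺ isClique? (subsets-unique n)))

  split : ∀ {A} → 𝓕 A → _
  split {A} A∈𝓕 with inClique? A
  ... | yes A∈ = inj₂ (A∈𝓕 , A∈)
  ... | no A∉ = inj₁ (A∈𝓕 , A∉)

  𝓗⊆Y : 𝓗 ⊆ binom (∁ Z) k
  𝓗⊆Y {A} (A∈𝓕 , A∉) =
    -- A vertex of `A` in `Z` lies in some clique, and isolation would put all of `A` inside it.
    (λ {x} x∈A → x∉p⇒x∈∁p λ x∈Z →
      let i , x∈K = x∈⋃⁻ part x∈Z in
      A∉ (part i , part-clique i ,
          isolation 𝓕⊆ ci (part-clique i) A∈𝓕 (x , x∈p∩q⁺ (x∈K , x∈A))))
    , proj₂ (𝓕⊆ A∈𝓕)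

  𝓑⊆Z : 𝓑 ⊆ binom Z k
  𝓑⊆Z (A∈𝓕 , K , Kc , A⊆K) =
    (let i , K≡ = part-complete Kc in x∈⋃⁺ part i ∘ subst (_ ∈_) K≡ ∘ A⊆K) , proj₂ (𝓕⊆ A∈𝓕)

  𝓗-unique : ∀ H → 𝓗 H → ContainsUniqueSubset 𝓗 (k ∸ 1) H
  𝓗-unique H (H∈𝓕 , H∉) with Fin.any? (λ x → (x ∈? H) ×-dec ¬? (replaceable? H x))
  ... | yes (x , x∈H , irr) =
    irreplaceable⇒uniqueSubset 𝓕⊆ proj₁ (proj₂ (𝓕⊆ H∈𝓕)) x∈H irr
  -- If every element of `H` is replaceable, completion puts `H` in a clique, contrary to `H∉`.
  ... | no none = contradiction
    (replaceable⇒inClique ci H∈𝓕 (proj₂ (𝓕⊆ H∈𝓕)) λ x x∈H →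
      decidable-stable (replaceable? H x) λ irr → none (x , x∈H , irr)) H∉
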